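{- The formal power series $I(b,\ell;r)$ and $J(b;r)$ satisfy, for integers $b$ and $\ell$: (i) $I(b,1;r)=(1+r)^{b+1}\frac{\partial}{\partial r}\big((1+r)^{ -b}J(b;r)\big)$ for $b\geq0$; (ii) $I(b,1;r)-I(b,0;r)=J(b;r)$ for $b\geq0$; (iii) $(1+r)^{b+1}\frac{\partial}{\partial r}\big((1+r)^{ -b}I(b,\ell;r)\big)=-\ell\,I(b,\ell;r)+\sum_{k=1}^\ell2k\,I(b,k;r)-\sum_{k=1}^b2k\,I(b,k;r)$ for $\ell,b\geq0$.
   Context: The formal power series in $r$ are defined by $$I(b,\ell;r)=\sum_{p=0}^\infty\frac{r^p}{(p!)^2}\prod_{m=0}^{p-1}(\ell^2-(b-m)^2),\qquad J(b;r)=\sum_{p=1}^\infty\frac{(-1)^{p+1}r^p}{p!(p-1)!}\prod_{m=0}^{p-2}(b-m)(b-m-1).$$ -}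

module Defs where

open import Data.Nat.Base as ℕ using (ℕ; zero; suc; _!; _∸_)
open import Data.Nat.Properties using (_!*_!≢0)
open import Data.Integer.Base as ℤ using (ℤ; +_; -[1+_]; 1ℤ; -1ℤ)
open import Data.Rational.Base as ℚ using (ℚ; 0ℚ; 1ℚ; _/_)
import Data.Rational.Properties as ℚ
open import Relation.Binary.PropositionalEquality using (_≡_; refl; trans; cong; cong₂)

infix  4 _≈_
infixl 6 _⊕_ _⊖_
infixl 7 _⊛_
infixr 8 _·_
infix  9 [1+r]^_

-- A formal power series in r over ℚ is its sequence of coefficients.
PowerSeries : Set
PowerSeries = ℕ → ℚ

_≈_ : PowerSeries → PowerSeries → Set
f ≈ g = ∀ n → f n ≡ g n

0# 1# : PowerSeries
0# _ = 0ℚ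
1# zero    = 1ℚ
1# (suc _) = 0ℚ

_⊕_ _⊖_ : PowerSeries → PowerSeries → PowerSeries
(f ⊕ g) n = f n ℚ.+ g n
(f ⊖ g) n = f n ℚ.- g n

_·_ : ℤ → PowerSeries → PowerSeries
(c · f) n = (c / 1) ℚ.* f n

-- sum≤ n a = a 0 + … + a n
sum≤ : ℕ → (ℕ → ℚ) → ℚ
sum≤ zero    a = a 0
sum≤ (suc n) a = sum≤ n a ℚ.+ a (suc n)

_⊛_ : PowerSeries → PowerSeries → PowerSeries
(f ⊛ g) n = sum≤ n (λ i → f i ℚ.* g (n ∸ i))

∂ : PowerSeries → PowerSeries
∂ f n = (+ suc n / 1) ℚ.* f (suc n)

1+r : PowerSeries
1+r zero          = 1ℚ
1+r (suc zero)    = 1ℚ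
1+r (suc (suc _)) = 0ℚ

-- The geometric series 1 - r + r² - …
1+r⁻¹ : PowerSeries
1+r⁻¹ zero    = 1ℚ
1+r⁻¹ (suc n) = ℚ.- 1+r⁻¹ n

1+r-inverse : 1+r ⊛ 1+r⁻¹ ≈ 1#
1+r-inverse zero    = refl
1+r-inverse (suc n) = trans (first-two n _) (ℚ.+-inverseˡ (1+r⁻¹ n))
  where
  first-two : ∀ n (a : ℕ → ℚ) → sum≤ (suc n) (λ i → 1+r i ℚ.* a i) ≡ a 0 ℚ.+ a 1
  first-two zero    a = cong₂ ℚ._+_ (ℚ.*-identityˡ (a 0)) (ℚ.*-identityˡ (a 1))
  first-two (suc n) a = trans
    (cong₂ ℚ._+_ (first-two n a) (ℚ.*-zeroˡ (a (suc (suc n)))))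
    (ℚ.+-identityʳ _)

[1+r]^_ : ℤ → PowerSeries
[1+r]^ (+ zero)     = 1#
[1+r]^ (+ suc n)    = 1+r ⊛ [1+r]^ (+ n)
[1+r]^ -[1+ zero ]  = 1+r⁻¹
[1+r]^ -[1+ suc n ] = 1+r⁻¹ ⊛ [1+r]^ -[1+ n ]

-- ∑₁ ℓ F = F 1 + … + F ℓ, the empty sum when ℓ ≤ 0
∑₁ : ℤ → (ℤ → PowerSeries) → PowerSeries
∑₁ (+ zero)   F = 0#
∑₁ (+ suc n)  F = ∑₁ (+ n) F ⊕ F (+ suc n)
∑₁ (-[1+ _ ]) F = 0#

-- ∏< p a = a 0 * … * a (p - 1)
∏< : ℕ → (ℕ → ℤ) → ℤ
∏< zero    a = 1ℤ
∏< (suc p) a = ∏< p a ℤ.* a p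

I : ℤ → ℤ → PowerSeries
I b ℓ p =
  (∏< p (λ m → ℓ ℤ.* ℓ ℤ.- (b ℤ.- + m) ℤ.* (b ℤ.- + m)) / (p ! ℕ.* p !))
    {{p !* p !≢0}}

-- The coefficient of r^p for p = suc q, so that p - 1 = q and
-- the product over 0 ≤ m ≤ p - 2 has q factors.
J : ℤ → PowerSeries
J b zero      = 0ℚ
J b p@(suc q) =
  (-1ℤ ℤ.^ (p ℕ.+ 1) ℤ.* ∏< q (λ m → (b ℤ.- + m) ℤ.* (b ℤ.- + m ℤ.- 1ℤ)) / (p ! ℕ.* q !))
    {{p !* q !≢0}}

{-# OPTIONS --safe #-}
-- Writing ∂_b f = (1+r)^{b+1} ∂((1+r)^{-b} f), one has ∂_b f = (1+r) f' - b f, so the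
-- coefficient of r^n in ∂_b f is (n+1) f_{n+1} + (n-b) f_n.  All coefficients of I and J are
-- hypergeometric terms, and for n ≥ 1
--   n I(b,1)_n = -(b-n)(b+1) J_n,   n I(b,0)_n = -b(b-n+1) J_n,
-- which gives (i) and (ii).  For (iii) the same kind of relation between I(b,ℓ+1)_n and
-- I(b,ℓ)_n shows that ∂_b I(b,ℓ) + ℓ I(b,ℓ) - ∑_{k≤ℓ} 2k I(b,k) does not depend on ℓ; it is
-- evaluated at ℓ = b, where I(b,b) = 1.
module Submission where

open import Defs
open import Data.Integer.Base using (ℤ; +_; 0ℤ; 1ℤ; -_; _+_; _*_; _≤_)
open import Data.Product.Base using (_×_; _,_)
open import Data.Integer.Base using (-1ℤ; _-_; _^_; +≤+)
import Data.Integer.Properties as ℤ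
open import Data.Nat.Base as ℕ using (ℕ; zero; suc; _!; _∸_)
import Data.Nat.Properties as ℕ
open import Data.Rational.Base as ℚ using (ℚ; 0ℚ; 1ℚ; _/_)
import Data.Rational.Properties as ℚ
open import Data.Rational.Unnormalised.Base as ℚᵘ using (mkℚᵘ; *≡*)
import Data.Rational.Unnormalised.Properties as ℚᵘ
open import Data.Integer.Solver using (module +-*-Solver)
import Data.Rational.Solver
open import Algebra.Properties.Group ℚ.+-0-group using () renaming (∙-cancelʳ to +-cancelʳ)
open import Relation.Binary.PropositionalEquality using (_≡_; refl; sym; trans; cong; cong₂; subst; module ≡-Reasoning)

open ≡-Reasoning
open +-*-Solver using (solve; con; _:+_; _:*_; _:-_; :-_; _:=_)
module QS = Data.Rational.Solver.+-*-Solver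

-- Fractions and the action of ℤ on ℚ

-- Equality of unnormalised rationals is cross-multiplication, and for a successor `d` the fraction
-- `x / d` is by definition the image of such a rational. Every comparison of coefficients below is
-- thereby reduced to an identity of integers.
/-cross : ∀ x y d e .{{_ : ℕ.NonZero d}} .{{_ : ℕ.NonZero e}} →
          x * + e ≡ y * + d → x / d ≡ y / e
/-cross x y (suc d) (suc e) eq = ℚ.fromℚᵘ-cong {mkℚᵘ x d} {mkℚᵘ y e} (*≡* eq)

-- The form in which scalars occur in `_·_` and `∂`, so that coefficients of those series unfold to
-- products with `ι`.
ι : ℤ → ℚ
ι z = z / 1

toℚᵘ-/ : ∀ x d → ℚ.toℚᵘ (x / suc d) ℚᵘ.≃ mkℚᵘ x d
toℚᵘ-/ x d = ℚ.toℚᵘ-fromℚᵘ (mkℚᵘ x d)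

-- Since `_/_` divides out the gcd, the product does not compute; the equation is checked on
-- unnormalised representatives.
ι-*-/ : ∀ c x d .{{_ : ℕ.NonZero d}} → ι c ℚ.* (x / d) ≡ (c * x) / d
ι-*-/ c x (suc d) = ℚ.toℚᵘ-injective
  (ℚᵘ.≃-trans (ℚ.toℚᵘ-homo-* (ι c) (x / suc d))
  (ℚᵘ.≃-trans (ℚᵘ.*-cong (toℚᵘ-/ c 0) (toℚᵘ-/ x d))
  (ℚᵘ.≃-trans (*≡* (cong (λ e → c * x * + suc e) (sym (ℕ.+-identityʳ d))))
  (ℚᵘ.≃-sym (toℚᵘ-/ (c * x) d)))))

ι-+ : ∀ x y → ι (x + y) ≡ ι x ℚ.+ ι y
ι-+ x y = ℚ.toℚᵘ-injective
  (ℚᵘ.≃-trans (toℚᵘ-/ (x + y) 0)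
  (ℚᵘ.≃-trans (*≡* (solve 2 (λ x y → (x :+ y) :* con 1ℤ
                      := (x :* con 1ℤ :+ y :* con 1ℤ) :* con 1ℤ) refl x y))
  (ℚᵘ.≃-trans (ℚᵘ.≃-sym (ℚᵘ.+-cong (toℚᵘ-/ x 0) (toℚᵘ-/ y 0)))
  (ℚᵘ.≃-sym (ℚ.toℚᵘ-homo-+ (ι x) (ι y))))))

ι-distrib : ∀ x y p → ι (x + y) ℚ.* p ≡ ι x ℚ.* p ℚ.+ ι y ℚ.* p
ι-distrib x y p = trans (cong (ℚ._* p) (ι-+ x y)) (ℚ.*-distribʳ-+ p (ι x) (ι y))

ι-assoc : ∀ x y p → ι (x * y) ℚ.* p ≡ ι x ℚ.* (ι y ℚ.* p)
ι-assoc x y p = trans (cong (ℚ._* p) (sym (ι-*-/ x y 1))) (ℚ.*-assoc (ι x) (ι y) p)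

ι-neg : ∀ x p → ι (- x) ℚ.* p ≡ ℚ.- (ι x ℚ.* p)
ι-neg x p = begin
  ι (- x) ℚ.* p                  ≡⟨ cong (λ z → ι z ℚ.* p) (sym (ℤ.-1*i≡-i x)) ⟩
  ι (-1ℤ * x) ℚ.* p              ≡⟨ ι-assoc -1ℤ x p ⟩
  (ℚ.- 1ℚ) ℚ.* (ι x ℚ.* p)       ≡⟨ QS.solve 1 (λ q → (QS.con (ℚ.- 1ℚ)) QS.:* q QS.:= QS.:- q) refl (ι x ℚ.* p) ⟩
  ℚ.- (ι x ℚ.* p)                ∎

-- Allows an identity between coefficients to be proved after multiplication by n+1, which clears
-- the denominators of the hypergeometric ratios.
ι-cancel : ∀ n {p q} → ι (+ suc n) ℚ.* p ≡ ι (+ suc n) ℚ.* q → p ≡ q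
ι-cancel n {p} {q} eq = begin
  p                              ≡⟨ inverse p ⟨
  u ℚ.* (ι (+ suc n) ℚ.* p)      ≡⟨ cong (u ℚ.*_) eq ⟩
  u ℚ.* (ι (+ suc n) ℚ.* q)      ≡⟨ inverse q ⟩
  q                              ∎
  where
  u = 1ℤ / suc n
  inverse : ∀ p → u ℚ.* (ι (+ suc n) ℚ.* p) ≡ p
  inverse p = begin
    u ℚ.* (ι (+ suc n) ℚ.* p)    ≡⟨ ℚ.*-assoc u (ι (+ suc n)) p ⟨
    u ℚ.* ι (+ suc n) ℚ.* p      ≡⟨ cong (ℚ._* p) (ℚ.*-comm u (ι (+ suc n))) ⟩
    ι (+ suc n) ℚ.* u ℚ.* p      ≡⟨ cong (ℚ._* p) (ι-*-/ (+ suc n) 1ℤ (suc n)) ⟩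
    ((+ suc n * 1ℤ) / suc n) ℚ.* p ≡⟨ cong (ℚ._* p) (/-cross (+ suc n * 1ℤ) 1ℤ (suc n) 1
                                        (solve 1 (λ n → n :* con 1ℤ :* con 1ℤ
                                                        := con 1ℤ :* n) refl (+ suc n))) ⟩
    1ℚ ℚ.* p                     ≡⟨ ℚ.*-identityˡ p ⟩
    p                            ∎

-- Power series

≈-trans : ∀ {f g h} → f ≈ g → g ≈ h → f ≈ h
≈-trans p q n = trans (p n) (q n)

≈-sym : ∀ {f g} → f ≈ g → g ≈ f
≈-sym p n = sym (p n)

sum≤-cong : ∀ n {a b : ℕ → ℚ} → (∀ i → a i ≡ b i) → sum≤ n a ≡ sum≤ n b
sum≤-cong zero    eq = eq 0
sum≤-cong (suc n) eq = cong₂ ℚ._+_ (sum≤-cong n eq) (eq (suc n))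

sum≤-+ : ∀ n (a b : ℕ → ℚ) → sum≤ n (λ i → a i ℚ.+ b i) ≡ sum≤ n a ℚ.+ sum≤ n b
sum≤-+ zero    a b = refl
sum≤-+ (suc n) a b = trans
  (cong (ℚ._+ (a (suc n) ℚ.+ b (suc n))) (sum≤-+ n a b))
  (QS.solve 4 (λ x y z w → x QS.:+ y QS.:+ (z QS.:+ w) QS.:= x QS.:+ z QS.:+ (y QS.:+ w)) refl
    (sum≤ n a) (sum≤ n b) (a (suc n)) (b (suc n)))

sum≤-head : ∀ n (a : ℕ → ℚ) → sum≤ (suc n) a ≡ a 0 ℚ.+ sum≤ n (λ i → a (suc i))
sum≤-head zero    a = refl
sum≤-head (suc n) a = trans
  (cong (ℚ._+ a (suc (suc n))) (sum≤-head n a))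
  (ℚ.+-assoc (a 0) (sum≤ n (λ i → a (suc i))) (a (suc (suc n))))

sum≤-zero : ∀ n {a : ℕ → ℚ} → (∀ i → a i ≡ 0ℚ) → sum≤ n a ≡ 0ℚ
sum≤-zero zero    eq = eq 0
sum≤-zero (suc n) eq = cong₂ ℚ._+_ (sum≤-zero n eq) (eq (suc n))

⊛-cong : ∀ {f f′ g g′} → f ≈ f′ → g ≈ g′ → f ⊛ g ≈ f′ ⊛ g′
⊛-cong p q n = sum≤-cong n (λ i → cong₂ ℚ._*_ (p i) (q (n ∸ i)))

⊛-congʳ : ∀ f {g g′} → g ≈ g′ → f ⊛ g ≈ f ⊛ g′
⊛-congʳ f = ⊛-cong {f} (λ _ → refl)

⊛-congˡ : ∀ {f f′} g → f ≈ f′ → f ⊛ g ≈ f′ ⊛ g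
⊛-congˡ g p = ⊛-cong {g = g} p (λ _ → refl)

⊛-identityˡ : ∀ f → 1# ⊛ f ≈ f
⊛-identityˡ f zero    = ℚ.*-identityˡ (f 0)
⊛-identityˡ f (suc n) = begin
  (1# ⊛ f) (suc n)
    ≡⟨ sum≤-head n (λ i → 1# i ℚ.* f (suc n ∸ i)) ⟩
  1ℚ ℚ.* f (suc n) ℚ.+ sum≤ n (λ i → 0ℚ ℚ.* f (n ∸ i))
    ≡⟨ cong₂ ℚ._+_ (ℚ.*-identityˡ (f (suc n))) (sum≤-zero n (λ i → ℚ.*-zeroˡ (f (n ∸ i)))) ⟩
  f (suc n) ℚ.+ 0ℚ
    ≡⟨ ℚ.+-identityʳ (f (suc n)) ⟩
  f (suc n) ∎

1+r-⊛-zero : ∀ f → (1+r ⊛ f) 0 ≡ f 0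
1+r-⊛-zero f = ℚ.*-identityˡ (f 0)

1+r-⊛-suc : ∀ f n → (1+r ⊛ f) (suc n) ≡ f (suc n) ℚ.+ f n
1+r-⊛-suc f n = begin
  (1+r ⊛ f) (suc n)
    ≡⟨ sum≤-head n (λ i → 1+r i ℚ.* f (suc n ∸ i)) ⟩
  1ℚ ℚ.* f (suc n) ℚ.+ sum≤ n (λ i → 1+r (suc i) ℚ.* f (n ∸ i))
    ≡⟨ cong₂ ℚ._+_ (ℚ.*-identityˡ (f (suc n)))
         (sum≤-cong n (λ i → cong (ℚ._* f (n ∸ i)) (shift i))) ⟩
  f (suc n) ℚ.+ (1# ⊛ f) n
    ≡⟨ cong (f (suc n) ℚ.+_) (⊛-identityˡ f n) ⟩
  f (suc n) ℚ.+ f n ∎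
  where
  shift : ∀ i → 1+r (suc i) ≡ 1# i
  shift zero    = refl
  shift (suc _) = refl

-- Multiplication by 1+r adds to each coefficient its predecessor, so associativity with this left
-- factor only requires splitting one sum in two.
1+r-⊛-assoc : ∀ g f → (1+r ⊛ g) ⊛ f ≈ 1+r ⊛ (g ⊛ f)
1+r-⊛-assoc g f zero    = ℚ.*-assoc 1ℚ (g 0) (f 0)
1+r-⊛-assoc g f (suc n) = begin
  ((1+r ⊛ g) ⊛ f) (suc n)
    ≡⟨ sum≤-head n (λ i → (1+r ⊛ g) i ℚ.* f (suc n ∸ i)) ⟩
  (1+r ⊛ g) 0 ℚ.* f (suc n) ℚ.+ sum≤ n (λ i → (1+r ⊛ g) (suc i) ℚ.* f (n ∸ i))
    ≡⟨ cong₂ ℚ._+_ (cong (ℚ._* f (suc n)) (1+r-⊛-zero g)) (sum≤-cong n expand) ⟩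
  g 0 ℚ.* f (suc n) ℚ.+ sum≤ n (λ i → tail i ℚ.+ g i ℚ.* f (n ∸ i))
    ≡⟨ cong (g 0 ℚ.* f (suc n) ℚ.+_) (sum≤-+ n tail (λ i → g i ℚ.* f (n ∸ i))) ⟩
  g 0 ℚ.* f (suc n) ℚ.+ (sum≤ n tail ℚ.+ (g ⊛ f) n)
    ≡⟨ ℚ.+-assoc (g 0 ℚ.* f (suc n)) (sum≤ n tail) ((g ⊛ f) n) ⟨
  g 0 ℚ.* f (suc n) ℚ.+ sum≤ n tail ℚ.+ (g ⊛ f) n
    ≡⟨ cong (ℚ._+ (g ⊛ f) n) (sum≤-head n (λ i → g i ℚ.* f (suc n ∸ i))) ⟨
  (g ⊛ f) (suc n) ℚ.+ (g ⊛ f) n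
    ≡⟨ 1+r-⊛-suc (g ⊛ f) n ⟨
  (1+r ⊛ (g ⊛ f)) (suc n) ∎
  where
  tail : ℕ → ℚ
  tail i = g (suc i) ℚ.* f (n ∸ i)
  expand : ∀ i → (1+r ⊛ g) (suc i) ℚ.* f (n ∸ i) ≡ tail i ℚ.+ g i ℚ.* f (n ∸ i)
  expand i = trans (cong (ℚ._* f (n ∸ i)) (1+r-⊛-suc g i))
                   (ℚ.*-distribʳ-+ (f (n ∸ i)) (g (suc i)) (g i))

1+r-⊛-1+r⁻¹-⊛ : ∀ f → 1+r ⊛ (1+r⁻¹ ⊛ f) ≈ f
1+r-⊛-1+r⁻¹-⊛ f = ≈-trans (≈-sym (1+r-⊛-assoc 1+r⁻¹ f))
  (≈-trans (⊛-congˡ f 1+r-inverse) (⊛-identityˡ f))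

-- The coefficients of f are recovered from those of (1+r) f one after another: the constant terms
-- agree, and f (n+1) is the coefficient of the product minus f n.
1+r-⊛-injective : ∀ {f g} → 1+r ⊛ f ≈ 1+r ⊛ g → f ≈ g
1+r-⊛-injective {f} {g} eq zero    = trans (sym (1+r-⊛-zero f)) (trans (eq 0) (1+r-⊛-zero g))
1+r-⊛-injective {f} {g} eq (suc n) = +-cancelʳ (f n) (f (suc n)) (g (suc n)) (begin
  f (suc n) ℚ.+ f n    ≡⟨ 1+r-⊛-suc f n ⟨
  (1+r ⊛ f) (suc n)    ≡⟨ eq (suc n) ⟩
  (1+r ⊛ g) (suc n)    ≡⟨ 1+r-⊛-suc g n ⟩
  g (suc n) ℚ.+ g n    ≡⟨ cong (g (suc n) ℚ.+_) (1+r-⊛-injective {f} {g} eq n) ⟨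
  g (suc n) ℚ.+ f n    ∎)

-- Multiplied by 1+r, both sides become g f, and 1+r cancels.
1+r⁻¹-⊛-assoc : ∀ g f → (1+r⁻¹ ⊛ g) ⊛ f ≈ 1+r⁻¹ ⊛ (g ⊛ f)
1+r⁻¹-⊛-assoc g f = 1+r-⊛-injective
  (≈-trans (≈-sym (1+r-⊛-assoc (1+r⁻¹ ⊛ g) f))
  (≈-trans (⊛-congˡ f (1+r-⊛-1+r⁻¹-⊛ g))
  (≈-sym (1+r-⊛-1+r⁻¹-⊛ (g ⊛ f)))))

-- The exponent -1 is a base case of `[1+r]^_` with value `1+r⁻¹`, not `1+r⁻¹ ⊛ 1#`; hence the
-- separate clause for `zero`.
neg-power-suc : ∀ b f → [1+r]^ (- + suc b) ⊛ f ≈ 1+r⁻¹ ⊛ ([1+r]^ (- + b) ⊛ f)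
neg-power-suc zero    f = ⊛-congʳ 1+r⁻¹ (≈-sym (⊛-identityˡ f))
neg-power-suc (suc b) f = 1+r⁻¹-⊛-assoc ([1+r]^ (- + suc b)) f

-- Puts the additional inverse factor next to f, so that the induction in `conjugate-∂` can absorb
-- it into its argument.
neg-power-suc′ : ∀ b f → [1+r]^ (- + suc b) ⊛ f ≈ [1+r]^ (- + b) ⊛ (1+r⁻¹ ⊛ f)
neg-power-suc′ zero    f = ≈-sym (⊛-identityˡ (1+r⁻¹ ⊛ f))
neg-power-suc′ (suc b) f =
  ≈-trans (neg-power-suc (suc b) f)
  (≈-trans (⊛-congʳ 1+r⁻¹ (neg-power-suc′ b f))
  (≈-sym (neg-power-suc b (1+r⁻¹ ⊛ f))))

-- The derivative conjugated by powers of 1+r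

∂-cong : ∀ {f g} → f ≈ g → ∂ f ≈ ∂ g
∂-cong p n = cong (ι (+ suc n) ℚ.*_) (p (suc n))

-- The series (1+r) f' - b f.
∂[_] : ℤ → PowerSeries → PowerSeries
∂[ b ] f n = ι (+ suc n) ℚ.* f (suc n) ℚ.+ ι (+ n - b) ℚ.* f n

∂[]-cong : ∀ b {f g} → f ≈ g → ∂[ b ] f ≈ ∂[ b ] g
∂[]-cong b p n = cong₂ ℚ._+_ (cong (ι (+ suc n) ℚ.*_) (p (suc n))) (cong (ι (+ n - b) ℚ.*_) (p n))

1+r-⊛-∂ : ∀ f → 1+r ⊛ ∂ f ≈ ∂[ 0ℤ ] f
1+r-⊛-∂ f zero    = trans (1+r-⊛-zero (∂ f))
  (sym (trans (cong (ι (+ 1) ℚ.* f 1 ℚ.+_) (ℚ.*-zeroˡ (f 0))) (ℚ.+-identityʳ (ι (+ 1) ℚ.* f 1))))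
1+r-⊛-∂ f (suc n) = trans (1+r-⊛-suc (∂ f) n)
  (cong (λ k → ι (+ suc (suc n)) ℚ.* f (suc (suc n)) ℚ.+ ι k ℚ.* f (suc n))
    (sym (ℤ.+-identityʳ (+ suc n))))

-- As ((1+r) h)' = (1+r) h' + h, multiplying (1+r) h' - b h by 1+r gives (1+r) ((1+r) h)' - (1+b)
-- (1+r) h: the derivative of the factor 1+r raises b by one.
1+r-⊛-∂[] : ∀ b h → 1+r ⊛ ∂[ b ] h ≈ ∂[ 1ℤ + b ] (1+r ⊛ h)
1+r-⊛-∂[] b h zero    = begin
  (1+r ⊛ ∂[ b ] h) 0
    ≡⟨ 1+r-⊛-zero (∂[ b ] h) ⟩
  ι (+ 1) ℚ.* h 1 ℚ.+ ι (0ℤ - b) ℚ.* h 0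
    ≡⟨ cong (λ k → ι (+ 1) ℚ.* h 1 ℚ.+ ι k ℚ.* h 0)
         (solve 1 (λ b → con 0ℤ :- b
            := con 1ℤ :+ (con 0ℤ :- (con 1ℤ :+ b))) refl b) ⟩
  ι (+ 1) ℚ.* h 1 ℚ.+ ι (1ℤ + (0ℤ - (1ℤ + b))) ℚ.* h 0
    ≡⟨ cong (ι (+ 1) ℚ.* h 1 ℚ.+_) (ι-distrib 1ℤ (0ℤ - (1ℤ + b)) (h 0)) ⟩
  ι (+ 1) ℚ.* h 1 ℚ.+ (ι (+ 1) ℚ.* h 0 ℚ.+ ι (0ℤ - (1ℤ + b)) ℚ.* h 0)
    ≡⟨ QS.solve 4 (λ u x y v → u QS.:* x QS.:+ (u QS.:* y QS.:+ v QS.:* y)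
          QS.:= u QS.:* (x QS.:+ y) QS.:+ v QS.:* y) refl (ι (+ 1)) (h 1) (h 0) (ι (0ℤ - (1ℤ + b))) ⟩
  ι (+ 1) ℚ.* (h 1 ℚ.+ h 0) ℚ.+ ι (0ℤ - (1ℤ + b)) ℚ.* h 0
    ≡⟨ cong₂ (λ x y → ι (+ 1) ℚ.* x ℚ.+ ι (0ℤ - (1ℤ + b)) ℚ.* y) (1+r-⊛-suc h 0) (1+r-⊛-zero h) ⟨
  ∂[ 1ℤ + b ] (1+r ⊛ h) 0 ∎
1+r-⊛-∂[] b h (suc n) = begin
  (1+r ⊛ ∂[ b ] h) (suc n)
    ≡⟨ 1+r-⊛-suc (∂[ b ] h) n ⟩
  ι (+ suc N) ℚ.* x ℚ.+ ι (+ N - b) ℚ.* y ℚ.+ (ι (+ N) ℚ.* y ℚ.+ ι (+ n - b) ℚ.* z)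
    ≡⟨ QS.solve 7 (λ a x c y d e z → a QS.:* x QS.:+ c QS.:* y QS.:+ (d QS.:* y QS.:+ e QS.:* z)
          QS.:= a QS.:* x QS.:+ (c QS.:* y QS.:+ d QS.:* y) QS.:+ e QS.:* z) refl
          (ι (+ suc N)) x (ι (+ N - b)) y (ι (+ N)) (ι (+ n - b)) z ⟩
  ι (+ suc N) ℚ.* x ℚ.+ (ι (+ N - b) ℚ.* y ℚ.+ ι (+ N) ℚ.* y) ℚ.+ ι (+ n - b) ℚ.* z
    ≡⟨ cong₂ (λ p k → ι (+ suc N) ℚ.* x ℚ.+ p ℚ.+ ι k ℚ.* z) middle last ⟩
  ι (+ suc N) ℚ.* x ℚ.+ (ι (+ suc N) ℚ.* y ℚ.+ ι k ℚ.* y) ℚ.+ ι k ℚ.* z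
    ≡⟨ QS.solve 5 (λ a x y k z → a QS.:* x QS.:+ (a QS.:* y QS.:+ k QS.:* y) QS.:+ k QS.:* z
          QS.:= a QS.:* (x QS.:+ y) QS.:+ k QS.:* (y QS.:+ z)) refl
          (ι (+ suc N)) x y (ι k) z ⟩
  ι (+ suc N) ℚ.* (x ℚ.+ y) ℚ.+ ι k ℚ.* (y ℚ.+ z)
    ≡⟨ cong₂ (λ p q → ι (+ suc N) ℚ.* p ℚ.+ ι k ℚ.* q) (1+r-⊛-suc h N) (1+r-⊛-suc h n) ⟨
  ∂[ 1ℤ + b ] (1+r ⊛ h) N ∎
  where
  N = suc n
  x = h (suc N)
  y = h N
  z = h n
  k = + N - (1ℤ + b)
  last : + n - b ≡ k
  last = solve 2 (λ n b → n :- b := (con 1ℤ :+ n) :- (con 1ℤ :+ b)) refl (+ n) b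
  middle : ι (+ N - b) ℚ.* y ℚ.+ ι (+ N) ℚ.* y ≡ ι (+ suc N) ℚ.* y ℚ.+ ι k ℚ.* y
  middle = begin
    ι (+ N - b) ℚ.* y ℚ.+ ι (+ N) ℚ.* y  ≡⟨ ι-distrib (+ N - b) (+ N) y ⟨
    ι (+ N - b + + N) ℚ.* y              ≡⟨ cong (λ j → ι j ℚ.* y)
        (solve 2 (λ N b → N :- b :+ N
           := (con 1ℤ :+ N) :+ (N :- (con 1ℤ :+ b))) refl (+ N) b) ⟩
    ι (+ suc N + k) ℚ.* y                ≡⟨ ι-distrib (+ suc N) k y ⟩
    ι (+ suc N) ℚ.* y ℚ.+ ι k ℚ.* y      ∎

conjugate-∂ : ∀ b f → [1+r]^ (+ suc b) ⊛ ∂ ([1+r]^ (- + b) ⊛ f) ≈ ∂[ + b ] f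
conjugate-∂ zero f =
  ≈-trans (1+r-⊛-assoc 1# (∂ (1# ⊛ f)))
  (≈-trans (⊛-congʳ 1+r (⊛-identityˡ (∂ (1# ⊛ f))))
  (≈-trans (⊛-congʳ 1+r (∂-cong (⊛-identityˡ f)))
  (1+r-⊛-∂ f)))
-- With f = (1+r) h the case b + 1 reduces to the case b applied to h.
conjugate-∂ (suc b) f =
  ≈-trans (⊛-congʳ ([1+r]^ (+ suc (suc b))) (∂-cong (neg-power-suc′ b f)))
  (≈-trans (1+r-⊛-assoc ([1+r]^ (+ suc b)) (∂ ([1+r]^ (- + b) ⊛ h)))
  (≈-trans (⊛-congʳ 1+r (conjugate-∂ b h))
  (≈-trans (1+r-⊛-∂[] (+ b) h)
  (∂[]-cong (+ suc b) (1+r-⊛-1+r⁻¹-⊛ f)))))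
  where h = 1+r⁻¹ ⊛ f

-- The exponent `+ b + 1ℤ` of the theorem reduces to `+ (b ℕ.+ 1)`, which is not definitionally
-- `+ suc b`.
conjugate-∂′ : ∀ b f → [1+r]^ (+ b + 1ℤ) ⊛ ∂ ([1+r]^ (- + b) ⊛ f) ≈ ∂[ + b ] f
conjugate-∂′ b f = subst (λ k → [1+r]^ (+ k) ⊛ ∂ ([1+r]^ (- + b) ⊛ f) ≈ ∂[ + b ] f)
  (ℕ.+-comm 1 b) (conjugate-∂ b f)

-- Coefficients of I

-- Unfolds to the factor inside `I`, so the numerator of `I b ℓ n` is `∏< n (I-factor b ℓ)` by
-- definition; `J-factor` serves `J` in the same way.
I-factor : ℤ → ℤ → ℕ → ℤ
I-factor b ℓ m = ℓ * ℓ - (b - + m) * (b - + m)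

J-factor : ℤ → ℕ → ℤ
J-factor b m = (b - + m) * (b - + m - 1ℤ)

!-suc : ∀ n → + (suc n !) ≡ + suc n * + (n !)
!-suc n = ℤ.pos-* (suc n) (n !)

I-suc : ∀ b ℓ n → ι (+ suc n) ℚ.* (ι (+ suc n) ℚ.* I b ℓ (suc n)) ≡ ι (I-factor b ℓ n) ℚ.* I b ℓ n
I-suc b ℓ n = begin
  ι N ℚ.* (ι N ℚ.* I b ℓ (suc n))       ≡⟨ cong (ι N ℚ.*_) (ι-*-/ N (P * c) D′) ⟩
  ι N ℚ.* ((N * (P * c)) / D′)          ≡⟨ ι-*-/ N (N * (P * c)) D′ ⟩
  (N * (N * (P * c))) / D′              ≡⟨ /-cross (N * (N * (P * c))) (c * P) D′ D cross ⟩
  (c * P) / D                           ≡⟨ ι-*-/ c P D ⟨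
  ι c ℚ.* I b ℓ n                       ∎
  where
  N = + suc n
  c = I-factor b ℓ n
  P = ∏< n (I-factor b ℓ)
  D = n ! ℕ.* n !
  D′ = suc n ! ℕ.* suc n !
  instance
    D≢0 = n ℕ.!* n !≢0
    D′≢0 = suc n ℕ.!* suc n !≢0
  cross : N * (N * (P * c)) * + D ≡ c * P * + D′
  cross = begin
    N * (N * (P * c)) * + D
      ≡⟨ cong (N * (N * (P * c)) *_) (ℤ.pos-* (n !) (n !)) ⟩
    N * (N * (P * c)) * (+ (n !) * + (n !))
      ≡⟨ solve 4 (λ N P c F → N :* (N :* (P :* c)) :* (F :* F)
           := c :* P :* (N :* F :* (N :* F))) refl N P c (+ (n !)) ⟩
    c * P * (N * + (n !) * (N * + (n !)))
      ≡⟨ cong (λ k → c * P * (k * k)) (!-suc n) ⟨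
    c * P * (+ (suc n !) * + (suc n !))
      ≡⟨ cong (c * P *_) (ℤ.pos-* (suc n !) (suc n !)) ⟨
    c * P * + D′ ∎

-- The m-th factor splits as (ℓ-b+m)(ℓ+b-m). Raising ℓ by one shifts each of the two resulting
-- products by one place, so their quotients telescope to (ℓ-b+n)/(ℓ-b) and (ℓ+1+b)/(ℓ+1+b-n). The
-- equation is cross-multiplied because these denominators can vanish.
∏-shift : ∀ b ℓ n →
  (ℓ + 1ℤ + b - + n) * (ℓ - b) * ∏< n (I-factor b (1ℤ + ℓ))
    ≡ (ℓ - b + + n) * (ℓ + 1ℤ + b) * ∏< n (I-factor b ℓ)
∏-shift b ℓ zero    = solve 2 (λ b ℓ →
  (ℓ :+ con 1ℤ :+ b :- con 0ℤ) :* (ℓ :- b) :* con 1ℤ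
    := (ℓ :- b :+ con 0ℤ) :* (ℓ :+ con 1ℤ :+ b) :* con 1ℤ) refl b ℓ
∏-shift b ℓ (suc n) = begin
  (ℓ + 1ℤ + b - + suc n) * (ℓ - b) * (P′ * I-factor b (1ℤ + ℓ) n)
    -- The new factor is (ℓ+1+b-n)(ℓ+1-b+n); its first half completes the left side of the induction
    -- hypothesis.
    ≡⟨ solve 4 (λ b ℓ n P →
         (ℓ :+ con 1ℤ :+ b :- (con 1ℤ :+ n)) :* (ℓ :- b)
           :* (P :* ((con 1ℤ :+ ℓ) :* (con 1ℤ :+ ℓ) :- (b :- n) :* (b :- n)))
         := (ℓ :+ con 1ℤ :+ b :- n) :* (ℓ :- b) :* P
           :* ((ℓ :+ b :- n) :* (ℓ :- b :+ (con 1ℤ :+ n)))) refl b ℓ (+ n) P′ ⟩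
  (ℓ + 1ℤ + b - + n) * (ℓ - b) * P′ * ((ℓ + b - + n) * (ℓ - b + + suc n))
    ≡⟨ cong (_* ((ℓ + b - + n) * (ℓ - b + + suc n))) (∏-shift b ℓ n) ⟩
  (ℓ - b + + n) * (ℓ + 1ℤ + b) * P * ((ℓ + b - + n) * (ℓ - b + + suc n))
    ≡⟨ solve 4 (λ b ℓ n P →
         (ℓ :- b :+ n) :* (ℓ :+ con 1ℤ :+ b) :* P
           :* ((ℓ :+ b :- n) :* (ℓ :- b :+ (con 1ℤ :+ n)))
         := (ℓ :- b :+ (con 1ℤ :+ n)) :* (ℓ :+ con 1ℤ :+ b)
           :* (P :* (ℓ :* ℓ :- (b :- n) :* (b :- n)))) refl b ℓ (+ n) P ⟩
  (ℓ - b + + suc n) * (ℓ + 1ℤ + b) * (P * I-factor b ℓ n) ∎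
  where
  P = ∏< n (I-factor b ℓ)
  P′ = ∏< n (I-factor b (1ℤ + ℓ))

I-shift : ∀ b ℓ n →
  ι ((ℓ + 1ℤ + b - + n) * (ℓ - b)) ℚ.* I b (1ℤ + ℓ) n
    ≡ ι ((ℓ - b + + n) * (ℓ + 1ℤ + b)) ℚ.* I b ℓ n
I-shift b ℓ n = begin
  ι A ℚ.* I b (1ℤ + ℓ) n                    ≡⟨ ι-*-/ A (∏< n (I-factor b (1ℤ + ℓ))) D ⟩
  (A * ∏< n (I-factor b (1ℤ + ℓ))) / D      ≡⟨ cong (λ x → x / D) (∏-shift b ℓ n) ⟩
  (A′ * ∏< n (I-factor b ℓ)) / D            ≡⟨ ι-*-/ A′ (∏< n (I-factor b ℓ)) D ⟨
  ι A′ ℚ.* I b ℓ n                          ∎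
  where
  A = (ℓ + 1ℤ + b - + n) * (ℓ - b)
  A′ = (ℓ - b + + n) * (ℓ + 1ℤ + b)
  D = n ! ℕ.* n !
  instance D≢0 = n ℕ.!* n !≢0

-- By `I-suc`, the factor n+1 turns the whole expression into a multiple of the single coefficient
-- `I b ℓ n`. The scalar c is kept free for the two values ℓ and -(1+ℓ).
∂[]-I : ∀ b ℓ c n →
  ι (+ suc n) ℚ.* (∂[ b ] (I b ℓ) n ℚ.+ ι c ℚ.* I b ℓ n)
    ≡ ι (I-factor b ℓ n + + suc n * (+ n - b + c)) ℚ.* I b ℓ n
∂[]-I b ℓ c n = begin
  ι N ℚ.* (ι N ℚ.* I b ℓ (suc n) ℚ.+ ι (+ n - b) ℚ.* i ℚ.+ ι c ℚ.* i)
    ≡⟨ cong (ι N ℚ.*_) (ℚ.+-assoc (ι N ℚ.* I b ℓ (suc n)) (ι (+ n - b) ℚ.* i) (ι c ℚ.* i)) ⟩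
  ι N ℚ.* (ι N ℚ.* I b ℓ (suc n) ℚ.+ (ι (+ n - b) ℚ.* i ℚ.+ ι c ℚ.* i))
    ≡⟨ cong (λ x → ι N ℚ.* (ι N ℚ.* I b ℓ (suc n) ℚ.+ x)) (ι-distrib (+ n - b) c i) ⟨
  ι N ℚ.* (ι N ℚ.* I b ℓ (suc n) ℚ.+ ι (+ n - b + c) ℚ.* i)
    ≡⟨ ℚ.*-distribˡ-+ (ι N) (ι N ℚ.* I b ℓ (suc n)) (ι (+ n - b + c) ℚ.* i) ⟩
  ι N ℚ.* (ι N ℚ.* I b ℓ (suc n)) ℚ.+ ι N ℚ.* (ι (+ n - b + c) ℚ.* i)
    ≡⟨ cong₂ ℚ._+_ (I-suc b ℓ n) (sym (ι-assoc N (+ n - b + c) i)) ⟩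
  ι (I-factor b ℓ n) ℚ.* i ℚ.+ ι (N * (+ n - b + c)) ℚ.* i
    ≡⟨ ι-distrib (I-factor b ℓ n) (N * (+ n - b + c)) i ⟨
  ι (I-factor b ℓ n + N * (+ n - b + c)) ℚ.* i ∎
  where
  N = + suc n
  i = I b ℓ n

-- For these two scalars the quadratic multiplier from `∂[]-I` factors, and the two sides become
-- exactly those of `I-shift`.
∂[]-I-step : ∀ b ℓ n →
  ∂[ b ] (I b (1ℤ + ℓ)) n ℚ.+ ι (- (1ℤ + ℓ)) ℚ.* I b (1ℤ + ℓ) n
    ≡ ∂[ b ] (I b ℓ) n ℚ.+ ι ℓ ℚ.* I b ℓ n
∂[]-I-step b ℓ n = ι-cancel n (begin
  ι (+ suc n) ℚ.* (∂[ b ] (I b (1ℤ + ℓ)) n ℚ.+ ι (- (1ℤ + ℓ)) ℚ.* I b (1ℤ + ℓ) n)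
    ≡⟨ ∂[]-I b (1ℤ + ℓ) (- (1ℤ + ℓ)) n ⟩
  ι (I-factor b (1ℤ + ℓ) n + + suc n * (+ n - b + - (1ℤ + ℓ))) ℚ.* I b (1ℤ + ℓ) n
    ≡⟨ cong (λ k → ι k ℚ.* I b (1ℤ + ℓ) n) (solve 3 (λ b ℓ n →
         (con 1ℤ :+ ℓ) :* (con 1ℤ :+ ℓ) :- (b :- n) :* (b :- n)
           :+ (con 1ℤ :+ n) :* (n :- b :+ :- (con 1ℤ :+ ℓ))
         := (ℓ :+ con 1ℤ :+ b :- n) :* (ℓ :- b)) refl b ℓ (+ n)) ⟩
  ι ((ℓ + 1ℤ + b - + n) * (ℓ - b)) ℚ.* I b (1ℤ + ℓ) n
    ≡⟨ I-shift b ℓ n ⟩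
  ι ((ℓ - b + + n) * (ℓ + 1ℤ + b)) ℚ.* I b ℓ n
    ≡⟨ cong (λ k → ι k ℚ.* I b ℓ n) (solve 3 (λ b ℓ n →
         (ℓ :- b :+ n) :* (ℓ :+ con 1ℤ :+ b)
         := ℓ :* ℓ :- (b :- n) :* (b :- n)
           :+ (con 1ℤ :+ n) :* (n :- b :+ ℓ)) refl b ℓ (+ n)) ⟩
  ι (I-factor b ℓ n + + suc n * (+ n - b + ℓ)) ℚ.* I b ℓ n
    ≡⟨ ∂[]-I b ℓ ℓ n ⟨
  ι (+ suc n) ℚ.* (∂[ b ] (I b ℓ) n ℚ.+ ι ℓ ℚ.* I b ℓ n) ∎)

-- This says I(b,b) = 1 apart from the constant term; the weight n covers n = 0 too. The ratio of
-- consecutive coefficients contains (2b-n) n, whose factor n is what the induction hypothesis asks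
-- for.
I-diagonal : ∀ b n → ι (+ n) ℚ.* I b b n ≡ 0ℚ
I-diagonal b zero    = ℚ.*-zeroˡ (I b b 0)
I-diagonal b (suc n) = ι-cancel n (begin
  ι N ℚ.* (ι N ℚ.* I b b (suc n))       ≡⟨ I-suc b b n ⟩
  ι (I-factor b b n) ℚ.* I b b n        ≡⟨ cong (λ k → ι k ℚ.* I b b n) (solve 2 (λ b n →
                                             b :* b :- (b :- n) :* (b :- n)
                                             := (b :+ b :- n) :* n) refl b (+ n)) ⟩
  ι ((b + b - + n) * + n) ℚ.* I b b n   ≡⟨ ι-assoc (b + b - + n) (+ n) (I b b n) ⟩
  ι (b + b - + n) ℚ.* (ι (+ n) ℚ.* I b b n) ≡⟨ cong (ι (b + b - + n) ℚ.*_) (I-diagonal b n) ⟩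
  ι (b + b - + n) ℚ.* 0ℚ                ≡⟨ ℚ.*-zeroʳ (ι (b + b - + n)) ⟩
  0ℚ                                    ≡⟨ ℚ.*-zeroʳ (ι N) ⟨
  ι N ℚ.* 0ℚ                            ∎)
  where N = + suc n

∂[]-I-diagonal : ∀ b n → ∂[ b ] (I b b) n ℚ.+ ι b ℚ.* I b b n ≡ 0ℚ
∂[]-I-diagonal b n = begin
  ι (+ suc n) ℚ.* I b b (suc n) ℚ.+ ι (+ n - b) ℚ.* i ℚ.+ ι b ℚ.* i
    ≡⟨ cong (λ x → x ℚ.+ ι (+ n - b) ℚ.* i ℚ.+ ι b ℚ.* i) (I-diagonal b (suc n)) ⟩
  0ℚ ℚ.+ ι (+ n - b) ℚ.* i ℚ.+ ι b ℚ.* i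
    ≡⟨ cong (ℚ._+ ι b ℚ.* i) (ℚ.+-identityˡ (ι (+ n - b) ℚ.* i)) ⟩
  ι (+ n - b) ℚ.* i ℚ.+ ι b ℚ.* i
    ≡⟨ ι-distrib (+ n - b) b i ⟨
  ι (+ n - b + b) ℚ.* i
    ≡⟨ cong (λ k → ι k ℚ.* i) (solve 2 (λ n b → n :- b :+ b := n) refl (+ n) b) ⟩
  ι (+ n) ℚ.* i
    ≡⟨ I-diagonal b n ⟩
  0ℚ ∎
  where i = I b b n

-- The recursion in ℓ and formula (iii)

∑2kI : ℤ → ℤ → PowerSeries
∑2kI b ℓ = ∑₁ ℓ (λ k → (+ 2 * k) · I b k)

defect : ℤ → ℕ → PowerSeries
defect b ℓ n = ∂[ b ] (I b (+ ℓ)) n ℚ.+ ι (+ ℓ) ℚ.* I b (+ ℓ) n ℚ.- ∑2kI b (+ ℓ) n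

-- The last summand 2(ℓ+1) I(b,ℓ+1) changes the term (ℓ+1) I(b,ℓ+1) into its negative, which is the
-- left side of `∂[]-I-step`.
defect-step : ∀ b ℓ → defect b (suc ℓ) ≈ defect b ℓ
defect-step b ℓ n = begin
  d ℚ.+ ι L ℚ.* i ℚ.- (s ℚ.+ ι (+ 2 * L) ℚ.* i)
    ≡⟨ cong (λ x → d ℚ.+ ι L ℚ.* i ℚ.- (s ℚ.+ x))
         (trans (cong (λ k → ι k ℚ.* i) (solve 1 (λ L → con (+ 2) :* L := L :+ L) refl L))
                (ι-distrib L L i)) ⟩
  d ℚ.+ ι L ℚ.* i ℚ.- (s ℚ.+ (ι L ℚ.* i ℚ.+ ι L ℚ.* i))
    ≡⟨ QS.solve 3 (λ d x s → d QS.:+ x QS.:- (s QS.:+ (x QS.:+ x)) QS.:= d QS.:+ QS.:- x QS.:- s)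
         refl d (ι L ℚ.* i) s ⟩
  d ℚ.+ ℚ.- (ι L ℚ.* i) ℚ.- s
    ≡⟨ cong (λ x → d ℚ.+ x ℚ.- s) (ι-neg L i) ⟨
  d ℚ.+ ι (- L) ℚ.* i ℚ.- s
    ≡⟨ cong (ℚ._- s) (∂[]-I-step b (+ ℓ) n) ⟩
  defect b ℓ n ∎
  where
  L = + suc ℓ
  d = ∂[ b ] (I b L) n
  i = I b L n
  s = ∑2kI b (+ ℓ) n

defect-const : ∀ b ℓ → defect b ℓ ≈ defect b 0
defect-const b zero    n = refl
defect-const b (suc ℓ) n = trans (defect-step b ℓ n) (defect-const b ℓ n)

∂[]-I-sum : ∀ b ℓ → ∂[ + b ] (I (+ b) (+ ℓ))
  ≈ (- + ℓ) · I (+ b) (+ ℓ) ⊕ ∑2kI (+ b) (+ ℓ) ⊖ ∑2kI (+ b) (+ b)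
∂[]-I-sum b ℓ n = begin
  d
    ≡⟨ QS.solve 3 (λ d x s → d QS.:= d QS.:+ x QS.:- s QS.:+ (QS.:- x QS.:+ s)) refl d (ι (+ ℓ) ℚ.* i) s ⟩
  defect (+ b) ℓ n ℚ.+ (ℚ.- (ι (+ ℓ) ℚ.* i) ℚ.+ s)
    ≡⟨ cong₂ (λ x y → x ℚ.+ (y ℚ.+ s)) at-b (sym (ι-neg (+ ℓ) i)) ⟩
  0ℚ ℚ.- t ℚ.+ (ι (- + ℓ) ℚ.* i ℚ.+ s)
    ≡⟨ QS.solve 3 (λ t x s → QS.con 0ℚ QS.:- t QS.:+ (x QS.:+ s) QS.:= x QS.:+ s QS.:- t)
         refl t (ι (- + ℓ) ℚ.* i) s ⟩
  ι (- + ℓ) ℚ.* i ℚ.+ s ℚ.- t ∎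
  where
  d = ∂[ + b ] (I (+ b) (+ ℓ)) n
  i = I (+ b) (+ ℓ) n
  s = ∑2kI (+ b) (+ ℓ) n
  t = ∑2kI (+ b) (+ b) n
  -- Descending from ℓ to 0 and climbing from 0 to b treats ℓ ≤ b and ℓ > b alike. At ℓ = b only the
  -- sum remains, since ∂_b 1 = -b.
  at-b : defect (+ b) ℓ n ≡ 0ℚ ℚ.- t
  at-b = begin
    defect (+ b) ℓ n  ≡⟨ defect-const (+ b) ℓ n ⟩
    defect (+ b) 0 n  ≡⟨ defect-const (+ b) b n ⟨
    defect (+ b) b n  ≡⟨ cong (ℚ._- t) (∂[]-I-diagonal (+ b) n) ⟩
    0ℚ ℚ.- t          ∎

-- Comparison of I with J

J-numerator : ℤ → ℕ → ℤ
J-numerator b q = -1ℤ ^ (suc q ℕ.+ 1) * ∏< q (J-factor b)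

-- One more sign, one more `J-factor`, and the factors q+2 and q+1 from the two factorials. The
-- nesting leaves the derivative term of `∂[ b ] (J b)` at q+1 as the inner product.
J-suc : ∀ b q → ι (+ suc q) ℚ.* (ι (+ suc (suc q)) ℚ.* J b (suc (suc q)))
  ≡ ι (- J-factor b q) ℚ.* J b (suc q)
J-suc b q = begin
  ι N ℚ.* (ι N′ ℚ.* J b (suc (suc q)))    ≡⟨ cong (ι N ℚ.*_) (ι-*-/ N′ (J-numerator b (suc q)) D′) ⟩
  ι N ℚ.* ((N′ * J-numerator b (suc q)) / D′) ≡⟨ ι-*-/ N (N′ * J-numerator b (suc q)) D′ ⟩
  (N * (N′ * J-numerator b (suc q))) / D′ ≡⟨ /-cross (N * (N′ * J-numerator b (suc q))) (c * J-numerator b q) D′ D cross ⟩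
  (c * J-numerator b q) / D               ≡⟨ ι-*-/ c (J-numerator b q) D ⟨
  ι c ℚ.* J b (suc q)                     ∎
  where
  N = + suc q
  N′ = + suc (suc q)
  c = - J-factor b q
  D = suc q ! ℕ.* q !
  D′ = suc (suc q) ! ℕ.* suc q !
  instance
    D≢0 = suc q ℕ.!* q !≢0
    D′≢0 = suc (suc q) ℕ.!* suc q !≢0
  cross : N * (N′ * J-numerator b (suc q)) * + D ≡ c * J-numerator b q * + D′
  cross = begin
    N * (N′ * J-numerator b (suc q)) * + D
      ≡⟨ cong (N * (N′ * J-numerator b (suc q)) *_) (ℤ.pos-* (suc q !) (q !)) ⟩
    N * (N′ * J-numerator b (suc q)) * (+ (suc q !) * + (q !))
      ≡⟨ solve 7 (λ N N′ ε P j F G →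
           N :* (N′ :* (con -1ℤ :* ε :* (P :* j))) :* (F :* G)
           := :- j :* (ε :* P) :* (N′ :* F :* (N :* G))) refl
           N N′ (-1ℤ ^ (suc q ℕ.+ 1)) (∏< q (J-factor b)) (J-factor b q) (+ (suc q !)) (+ (q !)) ⟩
    c * J-numerator b q * (N′ * + (suc q !) * (N * + (q !)))
      ≡⟨ cong₂ (λ x y → c * J-numerator b q * (x * y)) (!-suc (suc q)) (!-suc q) ⟨
    c * J-numerator b q * (+ (suc (suc q) !) * + (suc q !))
      ≡⟨ cong (c * J-numerator b q *_) (ℤ.pos-* (suc (suc q) !) (suc q !)) ⟨
    c * J-numerator b q * + D′ ∎

-- The denominators are p! p! and p! (p-1)! with p = q+1, so the factor p equalises them and only
-- the numerators have to be compared.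
I-by-J : ∀ b ℓ q c → ∏< (suc q) (I-factor b ℓ) ≡ c * J-numerator b q →
  ι (+ suc q) ℚ.* I b ℓ (suc q) ≡ ι c ℚ.* J b (suc q)
I-by-J b ℓ q c eq = begin
  ι N ℚ.* I b ℓ (suc q)           ≡⟨ ι-*-/ N P D′ ⟩
  (N * P) / D′                    ≡⟨ /-cross (N * P) (c * J-numerator b q) D′ D cross ⟩
  (c * J-numerator b q) / D       ≡⟨ ι-*-/ c (J-numerator b q) D ⟨
  ι c ℚ.* J b (suc q)             ∎
  where
  N = + suc q
  P = ∏< (suc q) (I-factor b ℓ)
  D = suc q ! ℕ.* q !
  D′ = suc q ! ℕ.* suc q !
  instance
    D≢0 = suc q ℕ.!* q !≢0
    D′≢0 = suc q ℕ.!* suc q !≢0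
  cross : N * P * + D ≡ c * J-numerator b q * + D′
  cross = begin
    N * P * + D
      ≡⟨ cong₂ (λ x y → N * x * y) eq (ℤ.pos-* (suc q !) (q !)) ⟩
    N * (c * J-numerator b q) * (+ (suc q !) * + (q !))
      ≡⟨ solve 4 (λ N x F G → N :* x :* (F :* G) := x :* (F :* (N :* G)))
           refl N (c * J-numerator b q) (+ (suc q !)) (+ (q !)) ⟩
    c * J-numerator b q * (+ (suc q !) * (N * + (q !)))
      ≡⟨ cong (λ x → c * J-numerator b q * (+ (suc q !) * x)) (!-suc q) ⟨
    c * J-numerator b q * (+ (suc q !) * + (suc q !))
      ≡⟨ cong (c * J-numerator b q *_) (ℤ.pos-* (suc q !) (suc q !)) ⟨
    c * J-numerator b q * + D′ ∎

-- From 1-(b-m)² = -(b-m-1)(b-m+1): for m ≤ q the first factors have the surplus b-(q+1) and the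
-- second ones the surplus b+1 over the product in J. One sign is left over.
∏-I₁ : ∀ b q → ∏< (suc q) (I-factor b 1ℤ) ≡ - ((b - + suc q) * (b + 1ℤ)) * J-numerator b q
∏-I₁ b zero    = solve 1 (λ b →
  con 1ℤ :* (con 1ℤ :- (b :- con 0ℤ) :* (b :- con 0ℤ))
  := :- ((b :- con 1ℤ) :* (b :+ con 1ℤ)) :* con 1ℤ) refl b
∏-I₁ b (suc q) = trans (cong (_* I-factor b 1ℤ (suc q)) (∏-I₁ b q))
  (solve 4 (λ b q ε P →
    let n = con 1ℤ :+ q in
    :- ((b :- n) :* (b :+ con 1ℤ)) :* (ε :* P)
      :* (con 1ℤ :- (b :- n) :* (b :- n))
    := :- ((b :- (con 1ℤ :+ n)) :* (b :+ con 1ℤ))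
      :* (con -1ℤ :* ε :* (P :* ((b :- q) :* (b :- q :- con 1ℤ)))))
    refl b (+ q) (-1ℤ ^ (suc q ℕ.+ 1)) (∏< q (J-factor b)))

-- Of the two copies of the product of b-m over m ≤ q, one releases its last factor b-q and the
-- other its first factor b; what remains is the product in J, up to sign.
∏-I₀ : ∀ b q → ∏< (suc q) (I-factor b 0ℤ) ≡ - (b * (b - + q)) * J-numerator b q
∏-I₀ b zero    = solve 1 (λ b →
  con 1ℤ :* (con 0ℤ :- (b :- con 0ℤ) :* (b :- con 0ℤ))
  := :- (b :* (b :- con 0ℤ)) :* con 1ℤ) refl b
∏-I₀ b (suc q) = trans (cong (_* I-factor b 0ℤ (suc q)) (∏-I₀ b q))
  (solve 4 (λ b q ε P →
    let n = con 1ℤ :+ q in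
    :- (b :* (b :- q)) :* (ε :* P)
      :* (con 0ℤ :- (b :- n) :* (b :- n))
    := :- (b :* (b :- n))
      :* (con -1ℤ :* ε :* (P :* ((b :- q) :* (b :- q :- con 1ℤ)))))
    refl b (+ q) (-1ℤ ^ (suc q ℕ.+ 1)) (∏< q (J-factor b)))

I₁-by-J : ∀ b q →
  ι (+ suc q) ℚ.* I b 1ℤ (suc q) ≡ ι (- ((b - + suc q) * (b + 1ℤ))) ℚ.* J b (suc q)
I₁-by-J b q = I-by-J b 1ℤ q (- ((b - + suc q) * (b + 1ℤ))) (∏-I₁ b q)

I₀-by-J : ∀ b q → ι (+ suc q) ℚ.* I b 0ℤ (suc q) ≡ ι (- (b * (b - + q))) ℚ.* J b (suc q)
I₀-by-J b q = I-by-J b 0ℤ q (- (b * (b - + q))) (∏-I₀ b q)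

I₁-as-∂[]J : ∀ b → I b 1ℤ ≈ ∂[ b ] (J b)
-- The constant terms are I(b,1)_0 = 1 = J_1, and J_0 = 0.
I₁-as-∂[]J b zero    = sym (cong (1ℚ ℚ.+_) (ℚ.*-zeroʳ (ι (0ℤ - b))))
I₁-as-∂[]J b (suc q) = ι-cancel q (begin
  ι N ℚ.* I b 1ℤ (suc q)
    ≡⟨ I₁-by-J b q ⟩
  ι (- ((b - N) * (b + 1ℤ))) ℚ.* j
    -- With n = q+1 the right side is -(b-n)(b-n+1) - n(b-n), with common factor b-n; its two terms
    -- are the contributions of J_{n+1} and J_n to ∂_b J.
    ≡⟨ cong (λ k → ι k ℚ.* j) (solve 2 (λ b q →
         let n = con 1ℤ :+ q in
         :- ((b :- n) :* (b :+ con 1ℤ))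
         := :- ((b :- q) :* (b :- q :- con 1ℤ)) :+ n :* (n :- b)) refl b (+ q)) ⟩
  ι (- J-factor b q + N * (N - b)) ℚ.* j
    ≡⟨ ι-distrib (- J-factor b q) (N * (N - b)) j ⟩
  ι (- J-factor b q) ℚ.* j ℚ.+ ι (N * (N - b)) ℚ.* j
    ≡⟨ cong₂ ℚ._+_ (sym (J-suc b q)) (ι-assoc N (N - b) j) ⟩
  ι N ℚ.* (ι (+ suc (suc q)) ℚ.* J b (suc (suc q))) ℚ.+ ι N ℚ.* (ι (N - b) ℚ.* j)
    ≡⟨ ℚ.*-distribˡ-+ (ι N) (ι (+ suc (suc q)) ℚ.* J b (suc (suc q))) (ι (N - b) ℚ.* j) ⟨
  ι N ℚ.* ∂[ b ] (J b) (suc q) ∎)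
  where
  N = + suc q
  j = J b (suc q)

I₁⊖I₀ : ∀ b → I b 1ℤ ⊖ I b 0ℤ ≈ J b
I₁⊖I₀ b zero    = refl
I₁⊖I₀ b (suc q) = ι-cancel q (begin
  ι N ℚ.* (I b 1ℤ (suc q) ℚ.- I b 0ℤ (suc q))
    ≡⟨ QS.solve 3 (λ n x y → n QS.:* (x QS.:- y) QS.:= n QS.:* x QS.:- n QS.:* y) refl
         (ι N) (I b 1ℤ (suc q)) (I b 0ℤ (suc q)) ⟩
  ι N ℚ.* I b 1ℤ (suc q) ℚ.- ι N ℚ.* I b 0ℤ (suc q)
    ≡⟨ cong₂ ℚ._-_ (I₁-by-J b q) (I₀-by-J b q) ⟩
  ι c₁ ℚ.* j ℚ.- ι c₀ ℚ.* j
    ≡⟨ cong (ι c₁ ℚ.* j ℚ.+_) (ι-neg c₀ j) ⟨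
  ι c₁ ℚ.* j ℚ.+ ι (- c₀) ℚ.* j
    ≡⟨ ι-distrib c₁ (- c₀) j ⟨
  ι (c₁ - c₀) ℚ.* j
    -- The difference of the two multipliers is n = q+1 itself, which cancels against the factor
    -- introduced by `ι-cancel`.
    ≡⟨ cong (λ k → ι k ℚ.* j) (solve 2 (λ b q →
         let n = con 1ℤ :+ q in
         :- ((b :- n) :* (b :+ con 1ℤ)) :- :- (b :* (b :- q))
         := n) refl b (+ q)) ⟩
  ι N ℚ.* j ∎)
  where
  N = + suc q
  j = J b (suc q)
  c₁ = - ((b - N) * (b + 1ℤ))
  c₀ = - (b * (b - + q))

lemma17 : (∀ (b : ℤ) → 0ℤ ≤ b →
    I b 1ℤ ≈ [1+r]^ (b + 1ℤ) ⊛ ∂ ([1+r]^ (- b) ⊛ J b))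
    ×
    (∀ (b : ℤ) → 0ℤ ≤ b →
    I b 1ℤ ⊖ I b 0ℤ ≈ J b)
    ×
    (∀ (b ℓ : ℤ) → 0ℤ ≤ ℓ → 0ℤ ≤ b →
    [1+r]^ (b + 1ℤ) ⊛ ∂ ([1+r]^ (- b) ⊛ I b ℓ)
    ≈ (- ℓ) · I b ℓ
    ⊕ ∑₁ ℓ (λ k → (+ 2 * k) · I b k)
    ⊖ ∑₁ b (λ k → (+ 2 * k) · I b k))
lemma17 =
    -- Matching on `+≤+` makes b a natural number, as the induction behind `conjugate-∂′` requires.
    (λ { (+ b) (+≤+ _) → ≈-trans (I₁-as-∂[]J (+ b)) (≈-sym (conjugate-∂′ b (J (+ b)))) })
  , (λ b _ → I₁⊖I₀ b)
  , (λ { (+ b) (+ ℓ) (+≤+ _) (+≤+ _) →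
         ≈-trans (conjugate-∂′ b (I (+ b) (+ ℓ))) (∂[]-I-sum b ℓ) })
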